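{- Every ($2K_2$, triangle)-free graph $G$ on $n$ vertices is recolorable, and the diameter of $R_\ell(G)$ is at most $2n^2$ for all $\ell\ge\chi(G)+1$.
   Context: All graphs are finite and simple. A $k$-coloring of $G$ is a map $V(G)\to\{1,\dots,k\}$ giving adjacent vertices different values; $\chi(G)$ is the chromatic number. $R_k(G)$ denotes the graph whose vertices are the $k$-colorings of $G$, two being adjacent if they differ in color on exactly one vertex. $G$ is recolorable if $R_\ell(G)$ is connected for all $\ell\ge\chi(G)+1$. A graph is $(H_1,H_2)$-free if it has no induced subgraph isomorphic to $H_1$ or $H_2$. $2K_2$ is the disjoint union of two edges; the triangle is $K_3$. -}

module Defs where

open import Data.Fin using (Fin)
open import Data.Fin.Properties using (_≟_; any?; all?)
open import Data.Nat using (ℕ; zero; suc; _+_; _≤_; z≤n; s≤s)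
open import Data.Product using (Σ; ∃; ∃!; _×_; _,_; proj₁; proj₂)
open import Data.Sum using (_⊎_)
open import Data.Sum.Relation.Binary.Pointwise
  using (Pointwise; inj₁; inj₂; ⊎-symmetric; ⊎-decidable)
open import Data.Vec using (Vec; []; _∷_; lookup; allFin)
open import Data.Vec.Properties using (lookup-allFin)
open import Function using (_∘_; _⇔_)
open import Function.Definitions using (Injective)
open import Relation.Binary.Core using (Rel)
open import Relation.Binary.Definitions using (Decidable; Irreflexive; Symmetric)
open import Relation.Binary.PropositionalEquality
  using (_≡_; _≢_; refl; subst; ≢-sym)
open import Relation.Nullary using (Dec; yes; no; ¬_; contradiction)
open import Relation.Nullary.Decidable using (map′; ¬?; _×-dec_; _→-dec_)
open import Level using (0ℓ)

-- A simple graph with vertex set V. Adjacency is decidable, which for a finite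
-- V is no restriction classically.
record Graph (V : Set) : Set₁ where
  field
    _~_      : Rel V 0ℓ
    _~?_     : Decidable _~_
    ~-sym    : Symmetric _~_
    ~-irrefl : Irreflexive _≡_ _~_

open Graph

K : ∀ m → Graph (Fin m)
K m = record
  { _~_      = _≢_
  ; _~?_     = λ u v → ¬? (u ≟ v)
  ; ~-sym    = ≢-sym
  ; ~-irrefl = λ u≡v u≢v → u≢v u≡v
  }

_⊕_ : ∀ {V W} → Graph V → Graph W → Graph (V ⊎ W)
G ⊕ H = record
  { _~_      = Pointwise (_~_ G) (_~_ H)
  ; _~?_     = ⊎-decidable (_~?_ G) (_~?_ H)
  ; ~-sym    = ⊎-symmetric (~-sym G) (~-sym H)
  ; ~-irrefl = λ { refl (inj₁ e) → ~-irrefl G refl e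
                 ; refl (inj₂ e) → ~-irrefl H refl e }
  }

triangle : Graph (Fin 3)
triangle = K 3

2K₂ : Graph (Fin 2 ⊎ Fin 2)
2K₂ = K 2 ⊕ K 2

record InducedIn {W V : Set} (H : Graph W) (G : Graph V) : Set where
  field
    embed     : W → V
    injective : Injective _≡_ _≡_ embed
    preserves : ∀ {x y} → _~_ H x y ⇔ _~_ G (embed x) (embed y)

Free : ∀ {W₁ W₂ V} → Graph W₁ → Graph W₂ → Graph V → Set
Free H₁ H₂ G = ¬ InducedIn H₁ G × ¬ InducedIn H₂ G

Proper : ∀ {n k} → Graph (Fin n) → Vec (Fin k) n → Set
Proper G c = ∀ u v → _~_ G u v → lookup c u ≢ lookup c v

-- Colorings are tables rather than functions, and Proper is definitionally
-- proof-irrelevant (it ends in ⊥), so _≡_ on colorings is equality of colorings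
-- as maps.
record Coloring {n : ℕ} (G : Graph (Fin n)) (k : ℕ) : Set where
  constructor coloring
  field
    colors : Vec (Fin k) n
    proper : Proper G colors

  color : Fin n → Fin k
  color = lookup colors

open Coloring

IsChromaticNumber : ∀ {n} → Graph (Fin n) → ℕ → Set
IsChromaticNumber G k = Coloring G k × (∀ j → Coloring G j → k ≤ j)

anyVec? : ∀ {k} n {P : Vec (Fin k) n → Set} → (∀ c → Dec (P c)) → Dec (∃ P)
anyVec? zero    P? = map′ (λ p → [] , p) (λ { ([] , p) → p }) (P? [])
anyVec? (suc n) P? =
  map′ (λ { (x , c , p) → x ∷ c , p }) (λ { (x ∷ c , p) → x , c , p })
       (any? λ x → anyVec? n λ c → P? (x ∷ c))

proper? : ∀ {n k} (G : Graph (Fin n)) (c : Vec (Fin k) n) → Dec (Proper G c)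
proper? G c =
  all? λ u → all? λ v → _~?_ G u v →-dec ¬? (lookup c u ≟ lookup c v)

colorable? : ∀ {n} (G : Graph (Fin n)) k → Dec (Coloring G k)
colorable? {n} G k =
  map′ (λ { (c , p) → coloring c p }) (λ c → colors c , proper c)
       (anyVec? n (proper? G))

rainbow : ∀ {n} (G : Graph (Fin n)) → Coloring G n
rainbow {n} G = coloring (allFin n) λ u v e eq →
  ~-irrefl G (subst (_≡ v) (lookup-allFin u) (subst (_ ≡_) (lookup-allFin v) eq)) e

least : ∀ {P : ℕ → Set} → (∀ k → Dec (P k)) → ∀ n → P n →
        Σ ℕ λ k → P k × (∀ j → P j → k ≤ j)
least P? zero    p = zero , p , λ _ _ → z≤n
least {P} P? (suc n) p with P? zero
... | yes p₀ = zero , p₀ , λ _ _ → z≤n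
... | no ¬p₀ with least (P? ∘ suc) n p
...   | k , pk , min = suc k , pk , λ
          { zero p₀ → contradiction p₀ ¬p₀ ; (suc j) pj → s≤s (min j pj) }

chromaticNumber : ∀ {n} (G : Graph (Fin n)) → ∃ (IsChromaticNumber G)
chromaticNumber {n} G = least (colorable? G) n (rainbow G)

χ : ∀ {n} → Graph (Fin n) → ℕ
χ G = proj₁ (chromaticNumber G)

DifferAtOne : ∀ {n k} {G : Graph (Fin n)} → Coloring G k → Coloring G k → Set
DifferAtOne c d = ∃! _≡_ λ v → color c v ≢ color d v

differAtOne? : ∀ {n k} {G : Graph (Fin n)} → Decidable (DifferAtOne {k = k} {G})
differAtOne? c d =
  map′ (λ { (v , p , u) → v , p , λ {w} → u w })
       (λ { (v , p , u) → v , p , λ w → u {w} })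
       (any? λ v → differ? v ×-dec all? λ w → differ? w →-dec (v ≟ w))
  where differ? = λ v → ¬? (color c v ≟ color d v)

R : ∀ {n} k (G : Graph (Fin n)) → Graph (Coloring G k)
R k G = record
  { _~_      = DifferAtOne
  ; _~?_     = differAtOne?
  ; ~-sym    = λ { (v , p , u) → v , ≢-sym p , λ q → u (≢-sym q) }
  ; ~-irrefl = λ { refl (v , p , u) → p refl }
  }

infixr 5 _∷_

data Walk {V : Set} (G : Graph V) : V → V → ℕ → Set where
  []  : ∀ {u} → Walk G u u 0
  _∷_ : ∀ {u v w m} → _~_ G u v → Walk G v w m → Walk G u w (suc m)

-- The empty graph is not regarded as connected.
Connected : ∀ {V} → Graph V → Set
Connected {V} G = V × (∀ u v → ∃ (Walk G u v))

IsDistance : ∀ {V} → Graph V → V → V → ℕ → Set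
IsDistance G u v d = Walk G u v d × (∀ m → Walk G u v m → d ≤ m)

-- The maximum of the distances: every pair is at some finite distance at most D,
-- and D is attained.
IsDiameter : ∀ {V} → Graph V → ℕ → Set
IsDiameter {V} G D =
  (∀ u v → ∃ λ d → IsDistance G u v d × d ≤ D) ×
  (Σ V λ u → Σ V λ v → IsDistance G u v D)

Recolorable : ∀ {n} → Graph (Fin n) → Set
Recolorable G = ∀ ℓ → χ G + 1 ≤ ℓ → Connected (R ℓ G)

{-# OPTIONS --safe #-}
module Submission where

-- Two colorings c and d such that c u ≢ d v for all edges u ~ v are joined by recoloring
-- the vertices once each, in any order. Hence a vertex may take the color of any vertex
-- whose neighborhood contains its own, all such vertices in the same sweep. A graph with
-- an edge and no 2K₂ or triangle has, up to isolated vertices, one of two shapes: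
--  * if it contains a closed walk of length 5, that walk is an induced 5-cycle, and every
--    vertex has its neighborhood contained in that of a vertex of the cycle;
--  * otherwise some edge ab is such that every edge joins N(a) to N(b), so every vertex
--    has its neighborhood contained in N(a) or N(b).
-- One sweep reduces a coloring to one that is given by the colors of the 5-cycle
-- (respectively of a and b); with 4 (respectively 3) colors, 8 (respectively 3) further
-- sweeps lead from one such coloring to any other. This gives 10 n steps, where n ≥ 5, or
-- 5 (n - 1) steps, as in the second case every sweep leaves some vertex unchanged.

open import Defs
open import Data.Fin using (Fin; inject≤; opposite; punchIn; punchOut)
open import Data.Fin.Patterns using (0F; 1F; 2F; 3F; 4F)
open import Data.Fin.Properties
  using (_≟_; any?; all?; inject≤-injective; injective⇒≤; punchIn-punchOut)
open import Data.List using (List; []; _∷_; length)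
import Data.List as List
import Data.List.Membership.DecPropositional as DecMembership
open import Data.List.Membership.Propositional using (_∈_)
open import Data.List.Membership.Propositional.Properties using (∈-allFin; ∈-tabulate⁺)
open import Data.List.Membership.Setoid.Properties using (index-injective)
open import Data.List.Properties using (length-tabulate)
open import Data.List.Relation.Unary.Any using (here; there; index)
open import Data.List.Relation.Unary.All using (All; []; _∷_)
open import Data.List.Relation.Unary.All.Properties using (¬Any⇒All¬)
open import Data.Nat using (ℕ; zero; suc; _+_; _*_; _^_; _∸_; _≤_; _<_; z≤n; s≤s)
import Data.Nat as ℕ
open import Data.Nat.Properties hiding (_≟_)
open import Data.Nat.Tactic.RingSolver using (solve-∀)
open import Data.Product using (Σ; ∃; ∃₂; _×_; _,_; proj₁; proj₂)
open import Data.Sum using (_⊎_; inj₁; inj₂; [_,_]′)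
open import Data.Sum.Relation.Binary.Pointwise using (inj₁; inj₂)
open import Data.Vec using (lookup; tabulate; _[_]≔_)
import Data.Vec.Properties as Vec
open import Function using (_∘_; mk⇔; id)
open import Relation.Binary.PropositionalEquality
open import Relation.Nullary using (Dec; yes; no; ¬_; contradiction)
open import Relation.Nullary.Decidable
  using (map′; _×-dec_; _⊎-dec_; ¬?; toWitness; decidable-stable)

open Coloring

-- Walks, diameters

module _ {V : Set} {G : Graph V} where
  open Graph G

  infixr 5 _++_
  _++_ : ∀ {u v w l m} → Walk G u v l → Walk G v w m → Walk G u w (l + m)
  []      ++ q = q
  (e ∷ p) ++ q = e ∷ (p ++ q)

  reverse : ∀ {u v m} → Walk G u v m → Walk G v u m
  reverse []                = []
  reverse {m = suc m} (e ∷ p) =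
    subst (Walk G _ _) (+-comm m 1) (reverse p ++ (~-sym e ∷ []))

  Within : ℕ → V → V → Set
  Within m u v = ∃ λ l → Walk G u v l × l ≤ m

  within-trans : ∀ {u v w l m} → Within l u v → Within m v w → Within (l + m) u w
  within-trans (_ , p , a) (_ , q , b) = _ , p ++ q , +-mono-≤ a b

  within-sym : ∀ {u v m} → Within m u v → Within m v u
  within-sym (_ , p , a) = _ , reverse p , a

  within-≤ : ∀ {u v l m} → l ≤ m → Within l u v → Within m u v
  within-≤ l≤m (_ , p , a) = _ , p , ≤-trans a l≤m

greatest : ∀ {P : ℕ → Set} → (∀ k → Dec (P k)) → ∀ b → (∀ k → P k → k ≤ b) → ∃ P →
           ∃ λ k → P k × (∀ j → P j → j ≤ k)
greatest P? b bound p with P? b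
greatest P? b       bound p       | yes pb = b , pb , bound
greatest {P} P? zero bound (k , p) | no ¬pb =
  contradiction (subst P (n≤0⇒n≡0 (bound k p)) p) ¬pb
greatest P? (suc b) bound p       | no ¬pb = greatest P? b
  (λ k pk → ℕ.s≤s⁻¹ (≤∧≢⇒< (bound k pk) λ { refl → ¬pb pk })) p

module _ {n k : ℕ} {G : Graph (Fin n)} where

  coloring-≡ : {c d : Coloring G k} → (∀ v → color c v ≡ color d v) → c ≡ d
  coloring-≡ {c} {d} eq = from-colors
    (trans (sym (Vec.tabulate∘lookup (colors c)))
           (trans (Vec.tabulate-cong eq) (Vec.tabulate∘lookup (colors d))))
    where
    from-colors : {c d : Coloring G k} → colors c ≡ colors d → c ≡ d
    from-colors refl = refl

  _≟ᶜ_ : (c d : Coloring G k) → Dec (c ≡ d)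
  c ≟ᶜ d = map′ coloring-≡ (λ { refl _ → refl }) (all? λ v → color c v ≟ color d v)

  anyColoring? : {P : Coloring G k → Set} → (∀ c → Dec (P c)) → Dec (∃ P)
  anyColoring? {P} P? =
    map′ (λ { (c , p , q) → coloring c p , q }) (λ { (coloring c p , q) → c , p , q })
         (anyVec? n λ c → helper c (proper? G c))
    where
    helper : ∀ c → Dec (Proper G c) → Dec (Σ (Proper G c) (P ∘ coloring c))
    helper c (no ¬p) = no (¬p ∘ proj₁)
    -- `Proper` is definitionally proof-irrelevant, so a witness for any proof of properness serves
    -- for `p`.
    helper c (yes p) = map′ (p ,_) proj₂ (P? (coloring c p))

  walk? : ∀ m (c d : Coloring G k) → Dec (Walk (R k G) c d m)
  walk? zero    c d = map′ (λ { refl → [] }) (λ { [] → refl }) (c ≟ᶜ d)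
  walk? (suc m) c d =
    map′ (λ { (_ , e , p) → e ∷ p }) (λ { (e ∷ p) → _ , e , p })
         (anyColoring? λ c′ → differAtOne? {G = G} c c′ ×-dec walk? m c′ d)

  distance : ∀ {m} (c d : Coloring G k) → Within {G = R k G} m c d →
             ∃ λ l → IsDistance (R k G) c d l × l ≤ m
  distance c d (l , p , l≤m) =
    let l′ , p′ , min = least (λ m → walk? m c d) l p
    in  l′ , (p′ , min) , ≤-trans (min l p) l≤m

  diameter : ∀ {m} → Coloring G k → (∀ c d → Within {G = R k G} m c d) →
             ∃ λ D → IsDiameter (R k G) D × D ≤ m
  diameter {m} c₀ within =
    let D , (c , d , eq) , max = greatest
          -- The diameter is the greatest value of `δ`. Being a value of `δ` is decidable by search
          -- through all pairs of colorings.
          (λ l → anyColoring? λ c → anyColoring? λ d → δ c d ℕ.≟ l) m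
          (λ { _ (c , d , refl) → δ≤m c d })
          (δ c₀ c₀ , c₀ , c₀ , refl)
    in  D , ( (λ c d → δ c d , isδ c d , max _ (c , d , refl))
            , c , d , subst (IsDistance _ c d) eq (isδ c d) )
          , subst (_≤ m) eq (δ≤m c d)
    where
    δ : (c d : Coloring G k) → ℕ
    δ c d = proj₁ (distance c d (within c d))
    isδ : ∀ c d → IsDistance (R k G) c d (δ c d)
    isδ c d = proj₁ (proj₂ (distance c d (within c d)))
    δ≤m : ∀ c d → δ c d ≤ m
    δ≤m c d = proj₂ (proj₂ (distance c d (within c d)))

-- Recoloring many vertices at once

module _ {n : ℕ} (G : Graph (Fin n)) {k : ℕ} where
  open Graph G

  -- Cross f g says that every mixture of f and g is a proper coloring, so that f can
  -- be turned into g one vertex at a time, in any order. Cross f f is properness of f.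
  Cross : (f g : Fin n → Fin k) → Set
  Cross f g = ∀ {u v} → u ~ v → f u ≢ g v

  private
    recolored : (c : Coloring G k) (v : Fin n) (x : Fin k) → Fin n → Fin k
    recolored c v x = lookup (colors c [ v ]≔ x)

    -- `P` also receives the vertex, so that nested uses can treat both ends of an edge.
    recolored-cases : ∀ (c : Coloring G k) {v x} (P : Fin n → Fin k → Set) →
                      P v x → (∀ w → P w (color c w)) → ∀ w → P w (recolored c v x w)
    recolored-cases c {v} {x} P pv pc w with w ≟ v
    ... | yes refl = subst (P v) (sym (Vec.lookup∘update v (colors c) x)) pv
    ... | no w≢v   = subst (P w) (sym (Vec.lookup∘update′ w≢v (colors c) x)) (pc w)

  -- Induction on `L`: giving its head the color under `d` produces a mixture of `c` and `d`, which
  -- is proper and again crosses `d`. A head on which `c` and `d` agree costs no step.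
  recolor-on : ∀ L (c d : Coloring G k) → Cross (color c) (color d) →
               (∀ v → color c v ≢ color d v → v ∈ L) → Within {G = R k G} (length L) c d
  recolor-on [] c d cross supp = 0 , subst (λ d → Walk _ c d 0) c≡d [] , z≤n
    where
    c≡d : c ≡ d
    c≡d = coloring-≡ λ v → decidable-stable (color c v ≟ color d v)
                              λ ne → contradiction (supp v ne) λ ()
  recolor-on (v ∷ L) c d cross supp with color c v ≟ color d v
  ... | yes eq = within-≤ (n≤1+n _) (recolor-on L c d cross supp′)
    where
    supp′ : ∀ w → color c w ≢ color d w → w ∈ L
    supp′ w ne with supp w ne
    ... | here refl = contradiction eq ne
    ... | there w∈L = w∈L
  ... | no ne =
    let l , p , l≤ = recolor-on L c′ d cross′ supp′
    in  suc l , step ∷ p , s≤s l≤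
    where
    new : Fin n → Fin k
    new = recolored c v (color d v)

    proper′ : Proper G (colors c [ v ]≔ color d v)
    proper′ = recolored-cases c (λ u x → ∀ w → u ~ w → x ≢ new w)
      (recolored-cases c (λ w y → v ~ w → color d v ≢ y)
        (λ v~v → contradiction v~v (~-irrefl refl))
        (λ _ v~w → ≢-sym (cross (~-sym v~w))))
      (λ u → recolored-cases c (λ w y → u ~ w → color c u ≢ y) cross (proper c u))

    c′ : Coloring G k
    c′ = coloring (colors c [ v ]≔ color d v) proper′

    cross′ : Cross new (color d)
    cross′ {u} {w} = recolored-cases c (λ u x → u ~ w → x ≢ color d w)
      (λ v~w → proper d v w v~w) (λ _ u~w → cross u~w) u

    supp′ : ∀ w → new w ≢ color d w → w ∈ L
    supp′ w ne′ with w ≟ v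
    ... | yes refl = contradiction (Vec.lookup∘update v (colors c) _) ne′
    ... | no w≢v with supp w (ne′ ∘ trans (Vec.lookup∘update′ w≢v (colors c) _))
    ...   | here w≡v  = contradiction w≡v w≢v
    ...   | there w∈L = w∈L

    step : DifferAtOne c c′
    step = v , (λ eq → ne (trans eq (Vec.lookup∘update v (colors c) _))) , unique
      where
      unique : ∀ {w} → color c w ≢ new w → v ≡ w
      unique {w} ne′ with w ≟ v
      ... | yes refl = refl
      ... | no w≢v   = contradiction (sym (Vec.lookup∘update′ w≢v (colors c) _)) ne′

  recolor : (c d : Coloring G k) → Cross (color c) (color d) → Within {G = R k G} n c d
  recolor c d cross = within-≤ (≤-reflexive (length-tabulate id))
    (recolor-on (List.allFin n) c d cross λ v _ → ∈-allFin v)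

recolor-fixing : ∀ {n k} (G : Graph (Fin n)) (c d : Coloring G k) →
                 Cross G (color c) (color d) → ∀ v → color c v ≡ color d v →
                 Within {G = R k G} (n ∸ 1) c d
recolor-fixing {suc n} G c d cross v eq = within-≤ (≤-reflexive (length-tabulate (punchIn v)))
  (recolor-on G (List.tabulate (punchIn v)) c d cross λ w ne →
    let v≢w = λ { refl → ne eq }
    in  subst (_∈ _) (punchIn-punchOut v≢w) (∈-tabulate⁺ (punchOut v≢w)))

-- Folding onto an induced subgraph

-- Recoloring each vertex u with the color of the representative r (φ u) keeps a coloring
-- proper, as the neighbors of u are neighbors of r (φ u). A coloring h of the
-- representatives then stands for the coloring h ∘ φ of G.
module Fold {n m : ℕ} (G : Graph (Fin n)) (φ : Fin n → Fin m) (r : Fin m → Fin n)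
            (dominated : ∀ {u v} → Graph._~_ G u v → Graph._~_ G (r (φ u)) v) {k : ℕ} where
  open Graph G

  reps : ∀ {u v} → u ~ v → r (φ u) ~ r (φ v)
  reps u~v = ~-sym (dominated (~-sym (dominated u~v)))

  CrossReps : (h h′ : Fin m → Fin k) → Set
  CrossReps h h′ = ∀ i j → r i ~ r j → h i ≢ h′ j

  module _ (h : Fin m → Fin k) (h-proper : CrossReps h h) where

    pull : Coloring G k
    pull = coloring (tabulate (h ∘ φ)) λ u v u~v eq → h-proper _ _ (reps u~v)
      (trans (sym (Vec.lookup∘tabulate (h ∘ φ) u)) (trans eq (Vec.lookup∘tabulate (h ∘ φ) v)))

    color-pull : ∀ v → color pull v ≡ h (φ v)
    color-pull = Vec.lookup∘tabulate (h ∘ φ)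

  cross-pull : ∀ {h h′} (p : CrossReps h h) (p′ : CrossReps h′ h′) → CrossReps h h′ →
               Cross G (color (pull h p)) (color (pull h′ p′))
  cross-pull {h} {h′} p p′ cross {u} {v} u~v eq = cross _ _ (reps u~v)
    (trans (sym (color-pull h p u)) (trans eq (color-pull h′ p′ v)))

  recolor-pull : ∀ {h h′} (p : CrossReps h h) (p′ : CrossReps h′ h′) → CrossReps h h′ →
                 Within {G = R k G} n (pull h p) (pull h′ p′)
  recolor-pull p p′ cross = recolor G _ _ (cross-pull p p′ cross)

  module _ (c : Coloring G k) where

    restrict : Fin m → Fin k
    restrict i = color c (r i)

    restrict-proper : CrossReps restrict restrict
    restrict-proper i j = proper c (r i) (r j)

    folded : Coloring G k
    folded = pull restrict restrict-proper

    -- `u` is adjacent to the representative of `v`, whose color `v` receives, so properness of `c`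
    -- suffices.
    cross-folded : Cross G (color c) (color folded)
    cross-folded {u} {v} u~v eq = proper c u (r (φ v)) (~-sym (dominated (~-sym u~v)))
      (trans eq (color-pull restrict restrict-proper v))

-- The structure of (2K₂, triangle)-free graphs

edgeEnds : {V : Set} → V → V → Fin 2 → V
edgeEnds a b 0F = a
edgeEnds a b 1F = b

module _ {V : Set} (G : Graph V) where
  open Graph G

  edgeEnds-adjacent : ∀ {a b} → a ~ b → ∀ x y → x ≢ y → edgeEnds a b x ~ edgeEnds a b y
  edgeEnds-adjacent a~b 0F 0F x≢y = contradiction refl x≢y
  edgeEnds-adjacent a~b 0F 1F x≢y = a~b
  edgeEnds-adjacent a~b 1F 0F x≢y = ~-sym a~b
  edgeEnds-adjacent a~b 1F 1F x≢y = contradiction refl x≢y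

  clique-injective : ∀ {m} (f : Fin m → V) → (∀ x y → x ≢ y → f x ~ f y) →
                     ∀ x y → f x ≡ f y → x ≡ y
  clique-injective f adj x y eq =
    decidable-stable (x ≟ y) λ x≢y → ~-irrefl eq (adj x y x≢y)

  clique : ∀ {m} (f : Fin m → V) → (∀ x y → x ≢ y → f x ~ f y) → InducedIn (K m) G
  clique f adj = record
    { embed     = f
    ; injective = clique-injective f adj _ _
    ; preserves = mk⇔ (adj _ _) λ { e refl → ~-irrefl refl e }
    }

  triangle-in : ∀ {a b c} → a ~ b → b ~ c → a ~ c → InducedIn triangle G
  triangle-in {a} {b} {c} a~b b~c a~c = clique f adj
    where
    f : Fin 3 → V
    f 0F = a
    f 1F = b
    f 2F = c
    adj : ∀ x y → x ≢ y → f x ~ f y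
    adj 0F 0F x≢y = contradiction refl x≢y
    adj 0F 1F x≢y = a~b
    adj 0F 2F x≢y = a~c
    adj 1F 0F x≢y = ~-sym a~b
    adj 1F 1F x≢y = contradiction refl x≢y
    adj 1F 2F x≢y = b~c
    adj 2F 0F x≢y = ~-sym a~c
    adj 2F 1F x≢y = ~-sym b~c
    adj 2F 2F x≢y = contradiction refl x≢y

  2K₂-in : ∀ {a b c d} → a ~ b → c ~ d →
           (∀ x y → ¬ edgeEnds a b x ~ edgeEnds c d y) → InducedIn 2K₂ G
  2K₂-in {a} {b} {c} {d} a~b c~d apart = record
    { embed     = f
    ; injective = f-injective
    ; preserves = λ {x} {y} → mk⇔ (to x y) (from x y)
    }
    where
    f : Fin 2 ⊎ Fin 2 → V
    f = [ edgeEnds a b , edgeEnds c d ]′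
    ab = edgeEnds-adjacent a~b
    cd = edgeEnds-adjacent c~d

    opposite-≢ : ∀ (x : Fin 2) → opposite x ≢ x
    opposite-≢ 0F ()
    opposite-≢ 1F ()

    -- A common end would be adjacent to the opposite end of `ab`, against `apart`.
    ends-≢ : ∀ x y → edgeEnds a b x ≢ edgeEnds c d y
    ends-≢ x y eq = apart (opposite x) y
      (subst (edgeEnds a b (opposite x) ~_) eq (ab _ _ (opposite-≢ x)))

    f-injective : ∀ {x y} → f x ≡ f y → x ≡ y
    f-injective {inj₁ x} {inj₁ y} eq = cong inj₁ (clique-injective (edgeEnds a b) ab x y eq)
    f-injective {inj₁ x} {inj₂ y} eq = contradiction eq (ends-≢ x y)
    f-injective {inj₂ x} {inj₁ y} eq = contradiction (sym eq) (ends-≢ y x)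
    f-injective {inj₂ x} {inj₂ y} eq = cong inj₂ (clique-injective (edgeEnds c d) cd x y eq)

    to : ∀ x y → Graph._~_ 2K₂ x y → f x ~ f y
    to _ _ (inj₁ x≢y) = ab _ _ x≢y
    to _ _ (inj₂ x≢y) = cd _ _ x≢y

    from : ∀ x y → f x ~ f y → Graph._~_ 2K₂ x y
    from (inj₁ x) (inj₁ y) e = inj₁ λ { refl → ~-irrefl refl e }
    from (inj₁ x) (inj₂ y) e = contradiction e (apart x y)
    from (inj₂ x) (inj₁ y) e = contradiction (~-sym e) (apart y x)
    from (inj₂ x) (inj₂ y) e = inj₂ λ { refl → ~-irrefl refl e }

-- Cyclic positions modulo 5

next prev : Fin 5 → Fin 5
next 0F = 1F
next 1F = 2F
next 2F = 3F
next 3F = 4F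
next 4F = 0F
prev 0F = 4F
prev 1F = 0F
prev 2F = 1F
prev 3F = 2F
prev 4F = 3F

next-prev : ∀ i → next (prev i) ≡ i
next-prev = toWitness {a? = all? λ i → next (prev i) ≟ i} _

prev-next : ∀ i → prev (next i) ≡ i
prev-next = toWitness {a? = all? λ i → prev (next i) ≟ i} _

next³≡prev² : ∀ i → next (next (next i)) ≡ prev (prev i)
next³≡prev² = toWitness {a? = all? λ i → next (next (next i)) ≟ prev (prev i)} _

data Position (i : Fin 5) : Fin 5 → Set where
  same   : Position i i
  after  : Position i (next i)
  before : Position i (prev i)
  2after  : Position i (next (next i))
  2before : Position i (prev (prev i))

position : ∀ i j → Position i j
position i j with toWitness {a? = all? λ i → all? λ j →
    (j ≟ i) ⊎-dec ((j ≟ next i) ⊎-dec ((j ≟ prev i) ⊎-dec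
      ((j ≟ next (next i)) ⊎-dec (j ≟ prev (prev i)))))} _ i j
... | inj₁ refl                      = same
... | inj₂ (inj₁ refl)               = after
... | inj₂ (inj₂ (inj₁ refl))        = before
... | inj₂ (inj₂ (inj₂ (inj₁ refl))) = 2after
... | inj₂ (inj₂ (inj₂ (inj₂ refl))) = 2before

-- Vertices may repeat here; in a triangle-free graph `no-chord` and `r-injective` make the walk an
-- induced 5-cycle.
Closed5Walk : ∀ {V} → Graph V → Set
Closed5Walk {V} G = Σ (Fin 5 → V) λ r → ∀ i → r i ~ r (next i)
  where open Graph G

module Structure {n : ℕ} (G : Graph (Fin n)) (free : Free 2K₂ triangle G) where
  open Graph G

  no-triangle : ∀ {a b c} → a ~ b → b ~ c → ¬ a ~ c
  no-triangle a~b b~c a~c = proj₂ free (triangle-in G a~b b~c a~c)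

  joined : ∀ {a b c d} → a ~ b → c ~ d → (a ~ c ⊎ a ~ d) ⊎ (b ~ c ⊎ b ~ d)
  joined {a} {b} {c} {d} a~b c~d = decidable-stable
    (((a ~? c) ⊎-dec (a ~? d)) ⊎-dec ((b ~? c) ⊎-dec (b ~? d)))
    λ none → proj₁ free (2K₂-in G a~b c~d λ
      { 0F 0F e → none (inj₁ (inj₁ e))
      ; 0F 1F e → none (inj₁ (inj₂ e))
      ; 1F 0F e → none (inj₂ (inj₁ e))
      ; 1F 1F e → none (inj₂ (inj₂ e)) })

  -- Graphs with a closed walk of length 5

  module Pentagon (r : Fin 5 → Fin n) (r-next : ∀ i → r i ~ r (next i)) where

    r-prev : ∀ i → r i ~ r (prev i)
    r-prev i = ~-sym (subst (λ j → r (prev i) ~ r j) (next-prev i) (r-next (prev i)))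

    r-opposite : ∀ i → r (next (next i)) ~ r (prev (prev i))
    r-opposite i = subst (λ j → r (next (next i)) ~ r j) (next³≡prev² i) (r-next (next (next i)))

    no-chord : ∀ i → ¬ r i ~ r (next (next i))
    no-chord i = no-triangle (r-next i) (r-next (next i))

    no-chord′ : ∀ i → ¬ r i ~ r (prev (prev i))
    no-chord′ i = no-triangle (r-prev i) (r-prev (prev i))

    r-injective : ∀ {i j} → r i ≡ r j → i ≡ j
    r-injective {i} {j} eq with position i j
    ... | same    = refl
    ... | after   = contradiction (r-next i) (~-irrefl eq)
    ... | before  = contradiction (r-prev i) (~-irrefl eq)
    ... | 2after  = contradiction
      (subst (_~ r (prev (prev i))) (sym eq) (r-opposite i)) (no-chord′ i)
    ... | 2before = contradiction
      (subst (_~ r (next (next i))) (sym eq) (~-sym (r-opposite i))) (no-chord i)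

    consecutive : ∀ i j → r i ~ r j → j ≡ next i ⊎ i ≡ next j
    consecutive i j e with position i j
    ... | same    = contradiction e (~-irrefl refl)
    ... | after   = inj₁ refl
    ... | before  = inj₂ (sym (next-prev i))
    ... | 2after  = contradiction e (no-chord i)
    ... | 2before = contradiction e (no-chord′ i)

    InClass : Fin n → Fin 5 → Set
    InClass u i = u ~ r (prev i) × u ~ r (next i)

    inClass? : ∀ u i → Dec (InClass u i)
    inClass? u i = (u ~? r (prev i)) ×-dec (u ~? r (next i))

    -- The edge from `u` to `r i` is joined to the cycle edge opposite `r i`. As `r i` has no chord,
    -- `u` sees an end of that edge, two places from `i`.
    neighbor-class : ∀ {u} i → u ~ r i → ∃ (InClass u)
    neighbor-class {u} i u~i with joined u~i (r-opposite i)
    ... | inj₁ (inj₁ e) = next i , subst (λ j → u ~ r j) (sym (prev-next i)) u~i , e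
    ... | inj₁ (inj₂ e) = prev i , e , subst (λ j → u ~ r j) (sym (next-prev i)) u~i
    ... | inj₂ (inj₁ e) = contradiction e (no-chord i)
    ... | inj₂ (inj₂ e) = contradiction e (no-chord′ i)

    -- If `u` sees no vertex of the cycle, then `w` has a class `j`. The edge opposite `r j` must be
    -- joined to `u ~ w` at `w`, which closes a triangle.
    some-class : ∀ {u w} → u ~ w → ∃ (InClass u)
    some-class {u} {w} u~w with any? (λ i → u ~? r i)
    ... | yes (i , u~i) = neighbor-class i u~i
    ... | no none = contradiction w-class λ { (j , w~prev , w~next) → apart j w~prev w~next }
      where
      w-class : ∃ (InClass w)
      w-class with joined u~w (r-next 0F)
      ... | inj₁ (inj₁ e) = contradiction (_ , e) none
      ... | inj₁ (inj₂ e) = contradiction (_ , e) none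
      ... | inj₂ (inj₁ e) = neighbor-class _ e
      ... | inj₂ (inj₂ e) = neighbor-class _ e
      apart : ∀ j → w ~ r (prev j) → ¬ w ~ r (next j)
      apart j w~prev w~next with joined u~w (r-opposite j)
      ... | inj₁ (inj₁ e) = none (_ , e)
      ... | inj₁ (inj₂ e) = none (_ , e)
      ... | inj₂ (inj₁ e) = no-triangle w~next (r-next (next j)) e
      ... | inj₂ (inj₂ e) = no-triangle w~prev (r-prev (prev j)) e

    -- Vertices without a class are isolated, and 0F is then as good as any other.
    class : Fin n → Fin 5
    class u with any? (inClass? u)
    ... | yes (i , _) = i
    ... | no _        = 0F

    class-correct : ∀ {u w} → u ~ w → InClass u (class u)
    class-correct {u} u~w with any? (inClass? u)
    ... | yes (_ , p) = p
    ... | no none     = contradiction (some-class u~w) none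

    -- If the classes are consecutive, `v` sees `r (class u)` by the definition of its class.
    -- Otherwise `u` and `v` have a common neighbor on the cycle, giving a triangle.
    dominated : ∀ {u v} → u ~ v → r (class u) ~ v
    dominated {u} {v} u~v
      with class u | class v | class-correct u~v | class-correct (~-sym u~v)
    ... | i | j | u~prev , u~next | v~prev , v~next with position i j
    ... | same    = contradiction u~next (no-triangle u~v v~next)
    ... | after   = ~-sym (subst (λ j → v ~ r j) (prev-next i) v~prev)
    ... | before  = ~-sym (subst (λ j → v ~ r j) (next-prev i) v~next)
    ... | 2after  = contradiction u~next
      (no-triangle u~v (subst (λ j → v ~ r j) (prev-next (next i)) v~prev))
    ... | 2before = contradiction u~prev
      (no-triangle u~v (subst (λ j → v ~ r j) (next-prev (prev i)) v~next))

  closed5Walk : ∀ {a b c d e} → a ~ b → b ~ c → c ~ d → d ~ e → e ~ a → Closed5Walk G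
  closed5Walk {a} {b} {c} {d} {e} a~b b~c c~d d~e e~a =
    (λ { 0F → a ; 1F → b ; 2F → c ; 3F → d ; 4F → e }) ,
    λ { 0F → a~b ; 1F → b~c ; 2F → c~d ; 3F → d~e ; 4F → e~a }

  closed5Walk? : Dec (Closed5Walk G)
  closed5Walk? = map′
    (λ { (a , b , c , d , e , p , q , s , t , u) → closed5Walk p q s t u })
    (λ { (r , p) → r 0F , r 1F , r 2F , r 3F , r 4F , p 0F , p 1F , p 2F , p 3F , p 4F })
    (any? λ a → any? λ b → any? λ c → any? λ d → any? λ e →
      (a ~? b) ×-dec (b ~? c) ×-dec (c ~? d) ×-dec (d ~? e) ×-dec (e ~? a))

  -- Graphs without a closed walk of length 5

  _≼_ : Fin n → Fin n → Set
  u ≼ v = ∀ {w} → u ~ w → v ~ w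

  Dominating : Fin n → Fin n → Set
  Dominating a b = ∀ {u v} → u ~ v → (a ~ u × b ~ v) ⊎ (b ~ u × a ~ v)

  module _ (no-5walk : ¬ Closed5Walk G) where

    -- If `v` is a neighbor of `u` only and `w` of `b` only, the edges `bw` and `uv` can be joined
    -- only by `w ~ v`, and `a b w v u` is a closed 5-walk.
    ≼-total : ∀ {a b u} → a ~ b → a ~ u → u ≼ b ⊎ b ≼ u
    ≼-total {a} {b} {u} a~b a~u with any? (λ v → (u ~? v) ×-dec ¬? (b ~? v))
    ... | no none = inj₁ λ {w} u~w →
      decidable-stable (b ~? w) λ b≁w → none (w , u~w , b≁w)
    ... | yes (v , u~v , b≁v) = inj₂ λ {w} b~w → decidable-stable (u ~? w) λ u≁w →
      [ [ no-triangle (~-sym a~b) a~u , b≁v ]′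
      , [ u≁w ∘ ~-sym
        , (λ w~v → no-5walk (closed5Walk a~b b~w w~v (~-sym u~v) (~-sym a~u))) ]′
      ]′ (joined b~w u~v)

    -- By `≼-total` the neighborhoods of the neighbors of `a` form a chain, so a running maximum
    -- works, starting from `b₀`.
    greatest-neighbor : ∀ {a b₀} → a ~ b₀ → ∃ λ b → a ~ b × (∀ {u} → a ~ u → u ≼ b)
    greatest-neighbor {a} {b₀} a~b₀ =
      let b , a~b , max = among (List.allFin n) in b , a~b , max (∈-allFin _)
      where
      among : ∀ L → ∃ λ b → a ~ b × (∀ {u} → u ∈ L → a ~ u → u ≼ b)
      among [] = b₀ , a~b₀ , λ ()
      among (u ∷ L) with among L | a ~? u
      ... | b , a~b , max | no a≁u = b , a~b , λ
        { (here refl) a~u → contradiction a~u a≁u ; (there u∈L) → max u∈L }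
      ... | b , a~b , max | yes a~u with ≼-total a~b a~u
      ...   | inj₁ u≼b = b , a~b , λ { (here refl) _ → u≼b ; (there u∈L) → max u∈L }
      ...   | inj₂ b≼u = u , a~u , λ
        { (here refl) _ → id ; (there u∈L) a~v v~w → b≼u (max u∈L a~v v~w) }

    -- Take b with greatest neighborhood among the neighbors of a₀, then a likewise
    -- among those of b; b is still greatest among the neighbors of a.
    dominating-edge : ∀ {a₀ b₀} → a₀ ~ b₀ → ∃₂ λ a b → a ~ b × Dominating a b
    dominating-edge {a₀} a₀~b₀ =
      let b , a₀~b , b-max = greatest-neighbor a₀~b₀
          a , b~a , a-max = greatest-neighbor (~-sym a₀~b)
          -- If `b` misses `w`, the edges `a₀b` and `uw` are joined at `a₀` or by `b ~ u`. From
          -- `a₀ ~ u` maximality gives `b ~ w`; from `a₀ ~ w` it gives `b ~ u`, which closes a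
          -- triangle with `a`.
          b-max′ = λ {u} a~u {w} u~w → decidable-stable (b ~? w) λ b≁w →
            [ [ (λ a₀~u → b≁w (b-max a₀~u u~w))
              , (λ a₀~w → no-triangle b~a a~u (b-max a₀~w (~-sym u~w))) ]′
            , [ no-triangle b~a a~u , b≁w ]′
            ]′ (joined a₀~b u~w)
      in  a , b , ~-sym b~a , λ {u} {v} u~v →
            [ [ (λ a~u → inj₁ (a~u , b-max′ {u} a~u u~v))
              , (λ a~v → inj₂ (b-max′ {v} a~v (~-sym u~v) , a~v)) ]′
            , [ (λ b~u → inj₂ (b~u , a-max b~u u~v))
              , (λ b~v → inj₁ (a-max b~v (~-sym u~v) , b~v)) ]′
            ]′ (joined (~-sym b~a) u~v)

-- Numbers of steps and of colors

n≤2n² : ∀ n → n ≤ 2 * n ^ 2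
n≤2n² zero    = z≤n
n≤2n² (suc m) = ≤-trans (m≤m+n _ _) (≤-reflexive (eq m))
  where
  eq : ∀ m → suc m + (2 * (m * m) + 3 * m + 1) ≡ 2 * (suc m * (suc m * 1))
  eq = solve-∀

-- With `5 * n` on the left this would fail for `n` = 2, a single edge; hence the use of
-- `recolor-fixing`.
5[n-1]≤2n² : ∀ n → let m = n ∸ 1 in m + (m + (m + (m + m))) ≤ 2 * n ^ 2
5[n-1]≤2n² 0 = z≤n
5[n-1]≤2n² 1 = z≤n
5[n-1]≤2n² (suc (suc m)) = ≤-trans (m≤m+n _ _) (≤-reflexive (eq m))
  where
  eq : ∀ m → (suc m + (suc m + (suc m + (suc m + suc m)))) + (2 * (m * m) + 3 * m + 3) ≡
             2 * (suc (suc m) * (suc (suc m) * 1))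
  eq = solve-∀

-- Equality holds at `n` = 5, so ten sweeps are exactly affordable on the 5-cycle itself.
10n≤2n² : ∀ {n} → 5 ≤ n → let 4n = n + (n + (n + n)) in 4n + (n + (n + 4n)) ≤ 2 * n ^ 2
10n≤2n² 5≤n with m≤n⇒∃[o]m+o≡n 5≤n
... | m , refl = ≤-trans (m≤m+n _ (2 * (m * (5 + m)))) (≤-reflexive (eq m))
  where
  eq : ∀ m → ((5 + m) + ((5 + m) + ((5 + m) + (5 + m)))) + ((5 + m) + ((5 + m) +
             ((5 + m) + ((5 + m) + ((5 + m) + (5 + m)))))) + 2 * (m * (5 + m)) ≡
             2 * ((5 + m) * ((5 + m) * 1))
  eq = solve-∀

-- Pigeonhole: if every color occurred in `xs`, its index there would be an injection into the
-- positions of `xs`.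
fresh : ∀ {k} (xs : List (Fin k)) → length xs < k → ∃ λ z → All (z ≢_) xs
fresh {k} xs short with any? (λ z → ¬? (DecMembership._∈?_ _≟_ z xs))
... | yes (z , z∉xs) = z , ¬Any⇒All¬ xs z∉xs
... | no none = contradiction
  (injective⇒≤ {f = λ z → index (covered z)} (index-injective (setoid (Fin k)) _ _))
  (<⇒≱ short)
  where
  covered : ∀ z → z ∈ xs
  covered z = decidable-stable (DecMembership._∈?_ _≟_ z xs) λ z∉xs → none (z , z∉xs)

distinct⇒2≤ : ∀ {k} {x y : Fin k} → x ≢ y → 2 ≤ k
distinct⇒2≤ {1} {0F} {0F} x≢y = contradiction refl x≢y
distinct⇒2≤ {suc (suc _)} x≢y = s≤s (s≤s z≤n)

alternate : ∀ {x y z : Fin 2} → x ≢ y → y ≢ z → x ≡ z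
alternate {0F} {0F} {_}  x≢y y≢z = contradiction refl x≢y
alternate {0F} {1F} {0F} x≢y y≢z = refl
alternate {0F} {1F} {1F} x≢y y≢z = contradiction refl y≢z
alternate {1F} {0F} {0F} x≢y y≢z = contradiction refl y≢z
alternate {1F} {0F} {1F} x≢y y≢z = refl
alternate {1F} {1F} {_}  x≢y y≢z = contradiction refl x≢y

-- Two colors would alternate along the walk, so `r 0F`, `r 2F` and `r 4F` would agree, against the
-- edge from `r 4F` to `r 0F`.
closed5Walk⇒3≤ : ∀ {n k} {G : Graph (Fin n)} → Closed5Walk G → Coloring G k → 3 ≤ k
closed5Walk⇒3≤ {k = k} (r , r-next) c with k | c | distinct⇒2≤ (proper c _ _ (r-next 0F))
... | 2 | c | _ = contradiction
  (sym (trans (alternate (step 0F) (step 1F)) (alternate (step 2F) (step 3F)))) (step 4F)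
  where
  step : ∀ i → color c (r i) ≢ color c (r (next i))
  step i = proper c _ _ (r-next i)
... | suc (suc (suc _)) | _ | _ = s≤s (s≤s (s≤s z≤n))
... | 1 | _ | s≤s ()

-- Recoloring through a dominating edge or a 5-cycle

module _ {n : ℕ} (G : Graph (Fin n)) (free : Free 2K₂ triangle G) where
  open Graph G
  open Structure G free

  module DominatingEdge {a b : Fin n} (a~b : a ~ b) (dominating : Dominating a b)
                        {k : ℕ} where

    -- Neighbors of `a` are represented by `b`, all other vertices by `a`; isolated vertices may go
    -- to either side.
    side : Fin n → Fin 2
    side u with a ~? u
    ... | yes _ = 1F
    ... | no _  = 0F

    side-a : side a ≡ 0F
    side-a with a ~? a
    ... | yes a~a = contradiction a~a (~-irrefl refl)
    ... | no _    = refl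

    side-b : side b ≡ 1F
    side-b with a ~? b
    ... | yes _   = refl
    ... | no a≁b = contradiction a~b a≁b

    dominated : ∀ {u v} → u ~ v → edgeEnds a b (side u) ~ v
    dominated {u} u~v with a ~? u | dominating u~v
    ... | yes _   | inj₁ (_ , b~v)   = b~v
    ... | yes a~u | inj₂ (b~u , _)   = contradiction a~u (no-triangle a~b b~u)
    ... | no a≁u  | inj₁ (a~u , _)   = contradiction a~u a≁u
    ... | no _    | inj₂ (_ , a~v)   = a~v

    open Fold G side (edgeEnds a b) dominated {k}

    cross-ends : ∀ {h h′} → h 0F ≢ h′ 1F → h′ 0F ≢ h 1F → CrossReps h h′
    cross-ends p q 0F 0F e = contradiction e (~-irrefl refl)
    cross-ends p q 0F 1F e = p
    cross-ends p q 1F 0F e = ≢-sym q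
    cross-ends p q 1F 1F e = contradiction e (~-irrefl refl)

    pull-fixing : ∀ {h h′} (p : CrossReps h h) (p′ : CrossReps h′ h′) → CrossReps h h′ →
                  ∀ v → h (side v) ≡ h′ (side v) →
                  Within {G = R k G} (n ∸ 1) (pull h p) (pull h′ p′)
    pull-fixing {h} {h′} p p′ cross v eq =
      recolor-fixing G _ _ (cross-pull p p′ cross) v
        (trans (color-pull h p v) (trans eq (sym (color-pull h′ p′ v))))

    -- `b` is its own representative and keeps its color.
    fold-fixing : ∀ c → Within {G = R k G} (n ∸ 1) c (folded c)
    fold-fixing c = recolor-fixing G c (folded c) (cross-folded c) b
      (sym (trans (color-pull _ (restrict-proper c) b) (cong (restrict c) side-b)))

    -- With (x , y) and (x′ , y′) the colors of (a , b), the recoloring is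
    -- (x , y) → (w , y) → (w , y′) → (x′ , y′). Every move fixes a or b.
    recolor-sides : 3 ≤ k → ∀ c d → let m = n ∸ 1 in
                    Within {G = R k G} (m + (m + (m + (m + m)))) c d
    recolor-sides 3≤k c d with fresh (color c b ∷ color d b ∷ []) 3≤k
    ... | w , w≢y ∷ w≢y′ ∷ [] =
      within-trans (fold-fixing c)
        (within-trans (pull-fixing (restrict-proper c) wy (cross-ends x≢y w≢y) b
                        (at (restrict c) (edgeEnds w _) side-b refl))
        (within-trans (pull-fixing wy wy′ (cross-ends w≢y′ w≢y) a
                        (at (edgeEnds w _) (edgeEnds w _) side-a refl))
        (within-trans (pull-fixing wy′ (restrict-proper d) (cross-ends w≢y′ x′≢y′) b
                        (at (edgeEnds w _) (restrict d) side-b refl))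
                      (within-sym (fold-fixing d)))))
      where
      x≢y   = proper c a b a~b
      x′≢y′ = proper d a b a~b
      wy : CrossReps (edgeEnds w (color c b)) (edgeEnds w (color c b))
      wy = cross-ends w≢y w≢y
      wy′ : CrossReps (edgeEnds w (color d b)) (edgeEnds w (color d b))
      wy′ = cross-ends w≢y′ w≢y′
      at : ∀ (h h′ : Fin 2 → Fin k) {i j} → i ≡ j → h j ≡ h′ j → h i ≡ h′ i
      at h h′ refl eq = eq

  module RecolorPentagon (r : Fin 5 → Fin n) (r-next : ∀ i → r i ~ r (next i))
                         {k : ℕ} where
    open Pentagon r r-next
    open Fold G class r dominated {k}

    cross-cyclic : ∀ {h h′} → (∀ i → h i ≢ h′ (next i)) → (∀ i → h′ i ≢ h (next i)) →
                   CrossReps h h′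
    cross-cyclic p q i j e with consecutive i j e
    ... | inj₁ refl = p i
    ... | inj₂ refl = ≢-sym (q j)

    -- The nonadjacent positions 0 and 2 share a color; in `tri` so do 1 and 3, which leaves a
    -- 3-coloring of the cycle.
    quad : (z x y w : Fin k) → Fin 5 → Fin k
    quad z x y w 0F = z
    quad z x y w 1F = x
    quad z x y w 2F = z
    quad z x y w 3F = y
    quad z x y w 4F = w

    tri : (z w w′ : Fin k) → Fin 5 → Fin k
    tri z w w′ = quad z w w w′

    cross-quad : ∀ {z x y w z′ x′ y′ w′} →
                 z ≢ x′ → z ≢ y′ → z ≢ w′ → z′ ≢ x → z′ ≢ y → z′ ≢ w → y ≢ w′ → y′ ≢ w →
                 CrossReps (quad z x y w) (quad z′ x′ y′ w′)
    cross-quad zx′ zy′ zw′ z′x z′y z′w yw′ y′w = cross-cyclic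
      (λ { 0F → zx′ ; 1F → ≢-sym z′x ; 2F → zy′ ; 3F → yw′ ; 4F → ≢-sym z′w })
      (λ { 0F → z′x ; 1F → ≢-sym zx′ ; 2F → z′y ; 3F → y′w ; 4F → ≢-sym zw′ })

    cross-tri : ∀ {z u w z′ u′ w′} → z ≢ u′ → z ≢ w′ → z′ ≢ u → z′ ≢ w → u ≢ w′ → u′ ≢ w →
                CrossReps (tri z u w) (tri z′ u′ w′)
    cross-tri zu′ zw′ z′u z′w uw′ u′w = cross-quad zu′ zu′ zw′ z′u z′u z′w uw′ u′w

    tri-proper : ∀ {z u w} → z ≢ u → z ≢ w → u ≢ w → CrossReps (tri z u w) (tri z u w)
    tri-proper zu zw uw = cross-tri zu zw zu zw uw uw

    -- (x₀ , x₁ , x₂ , x₃ , x₄) → (z , x₁ , z , x₃ , x₄) → (z , u , z , u , x₄)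
    -- → (z , u , z , u , w).
    to-tri : ∀ c {z u w} → let x = restrict c in
             z ≢ x 1F → z ≢ x 3F → z ≢ x 4F → u ≢ x 4F →
             (zu : z ≢ u) (zw : z ≢ w) (uw : u ≢ w) →
             Within {G = R k G} (n + (n + (n + n))) c (pull (tri z u w) (tri-proper zu zw uw))
    to-tri c {z} {u} {w} zx₁ zx₃ zx₄ ux₄ zu zw uw =
      within-trans (recolor G _ _ (cross-folded c))
      (within-trans (recolor-pull (restrict-proper c) proper₁ (cross-cyclic
        (λ { 0F → step 0F ; 1F → ≢-sym zx₁ ; 2F → step 2F ; 3F → step 3F ; 4F → ≢-sym zx₄ })
        (λ { 0F → zx₁ ; 1F → step 1F ; 2F → zx₃ ; 3F → step 3F ; 4F → step 4F })))
      (within-trans (recolor-pull proper₁ proper₂ (cross-quad zu zu zx₄ zx₁ zx₃ zx₄ x₃x₄ ux₄))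
                    (recolor-pull proper₂ (tri-proper zu zw uw)
                      (cross-tri zu zw zu zx₄ uw ux₄))))
      where
      x = restrict c
      step : ∀ i → x i ≢ x (next i)
      step i = proper c _ _ (r-next i)
      x₃x₄ = step 3F
      proper₁ : CrossReps (quad z (x 1F) (x 3F) (x 4F)) (quad z (x 1F) (x 3F) (x 4F))
      proper₁ = cross-quad zx₁ zx₃ zx₄ zx₁ zx₃ zx₄ x₃x₄ x₃x₄
      proper₂ : CrossReps (tri z u (x 4F)) (tri z u (x 4F))
      proper₂ = tri-proper zu zx₄ ux₄

    -- The route runs from `c` through `tri z u w`, `tri z′ u w` and `tri z′ t w` to `d`. Each new
    -- color avoids only three others, so four colors suffice; `u` is adapted to `c` at position 4,
    -- and `t` to `d`.
    recolor-pentagon : 4 ≤ k → ∀ c d → let 4n = n + (n + (n + n)) in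
                       Within {G = R k G} (4n + (n + (n + 4n))) c d
    recolor-pentagon 4≤k c d
      with z  , zx₁ ∷ zx₃ ∷ zx₄ ∷ [] ←
             fresh (restrict c 1F ∷ restrict c 3F ∷ restrict c 4F ∷ []) 4≤k
         | z′ , z′y₁ ∷ z′y₃ ∷ z′y₄ ∷ [] ←
             fresh (restrict d 1F ∷ restrict d 3F ∷ restrict d 4F ∷ []) 4≤k
      with u , uz ∷ uz′ ∷ ux₄ ∷ []  ← fresh (z ∷ z′ ∷ restrict c 4F ∷ []) 4≤k
      with w , wz ∷ wz′ ∷ wu ∷ []   ← fresh (z ∷ z′ ∷ u ∷ []) 4≤k
      with t , tz′ ∷ tw ∷ ty₄ ∷ []  ← fresh (z′ ∷ w ∷ restrict d 4F ∷ []) 4≤k =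
      let zu = ≢-sym uz ; zw = ≢-sym wz ; uw = ≢-sym wu
          z′u = ≢-sym uz′ ; z′w = ≢-sym wz′ ; z′t = ≢-sym tz′
      in  within-trans (to-tri c zx₁ zx₃ zx₄ ux₄ zu zw uw)
          (within-trans (recolor-pull (tri-proper zu zw uw) (tri-proper z′u z′w uw)
                          (cross-tri zu zw z′u z′w uw uw))
          (within-trans (recolor-pull (tri-proper z′u z′w uw) (tri-proper z′t z′w tw)
                          (cross-tri z′t z′w z′u z′w uw tw))
                        (within-sym (to-tri d z′y₁ z′y₃ z′y₄ ty₄ z′t z′w tw))))

  private
    χ-coloring : Coloring G (χ G)
    χ-coloring = proj₁ (proj₂ (chromaticNumber G))

  within-2n² : ∀ {ℓ} → χ G + 1 ≤ ℓ → ∀ c d → Within {G = R ℓ G} (2 * n ^ 2) c d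
  within-2n² χ<ℓ c d with any? (λ a → any? (a ~?_))
  ... | no edgeless = within-≤ (n≤2n² n)
    (recolor G c d λ {u} {v} u~v → contradiction (u , v , u~v) edgeless)
  ... | yes (a₀ , b₀ , a₀~b₀) with closed5Walk?
  ...   | yes (r , r-next) = within-≤
    (10n≤2n² (injective⇒≤ {f = r} (Pentagon.r-injective r r-next)))
    (RecolorPentagon.recolor-pentagon r r-next
      -- The closed 5-walk forces `3 ≤ χ G`, hence `4 ≤ ℓ`.
      (≤-trans (+-monoˡ-≤ 1 (closed5Walk⇒3≤ (r , r-next) χ-coloring)) χ<ℓ) c d)
  ...   | no no-5walk =
    let a , b , a~b , dom = dominating-edge no-5walk a₀~b₀
    in  within-≤ (5[n-1]≤2n² n) (DominatingEdge.recolor-sides a~b dom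
          (≤-trans (+-monoˡ-≤ 1 (distinct⇒2≤ (proper χ-coloring _ _ a~b))) χ<ℓ) c d)

  some-coloring : ∀ {ℓ} → χ G + 1 ≤ ℓ → Coloring G ℓ
  some-coloring χ<ℓ = coloring (tabulate f) λ u v u~v eq → proper χ-coloring u v u~v
    (inject≤-injective χ≤ℓ χ≤ℓ _ _
      (trans (sym (Vec.lookup∘tabulate f u)) (trans eq (Vec.lookup∘tabulate f v))))
    where
    χ≤ℓ = ≤-trans (m≤m+n (χ G) 1) χ<ℓ
    f = λ v → inject≤ (color χ-coloring v) χ≤ℓ

theorem10 : ∀ (n : ℕ) (G : Graph (Fin n)) → Free 2K₂ triangle G →
    Recolorable G ×
    (∀ (ℓ : ℕ) → χ G + 1 ≤ ℓ → ∃ λ D → IsDiameter (R ℓ G) D × D ≤ 2 * n ^ 2)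
theorem10 n G free =
  (λ ℓ χ<ℓ → some-coloring G free χ<ℓ , λ c d →
    let l , p , _ = within-2n² G free χ<ℓ c d in l , p) ,
  (λ ℓ χ<ℓ → diameter (some-coloring G free χ<ℓ) (within-2n² G free χ<ℓ))
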